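{- For every even positive integer $n$ there exists a bijection $\psi\colon\{0,1\}^n\to\mathcal{B}_n$, where $\mathcal{B}_n=\{x\in\{0,1\}^{n+1}: |x|>n/2\}$, such that for all $x\ne y$ in $\{0,1\}^n$, \[ \frac15\le\frac{\mathrm{distance}(\psi(x),\psi(y))}{\mathrm{distance}(x,y)}\le 4 . \]
   Context: For a binary string $x$, $|x|$ denotes its Hamming weight (number of ones), and $\mathrm{distance}(\cdot,\cdot)$ denotes the Hamming distance between binary strings of equal length. -}

module Defs where

open import Data.Bool.Base using (Bool; true)
open import Data.Bool.Properties using (_≟_)
open import Data.Empty using (⊥-elim)
open import Data.Nat.Base using (ℕ; suc; _>_; _/_; NonZero)
open import Data.Product.Base using (Σ-syntax; _,_)
open import Data.Vec.Base using (Vec; []; _∷_; count; zip)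
open import Relation.Binary.PropositionalEquality using (_≢_; refl; cong)
open import Relation.Nullary.Decidable.Core using (yes; no; ¬?)

BitString : ℕ → Set
BitString n = Vec Bool n

weight : ∀ {n} → BitString n → ℕ
weight x = count (_≟ true) x

distance : ∀ {n} → BitString n → BitString n → ℕ
distance x y = count (λ (a , b) → ¬? (a ≟ b)) (zip x y)

-- The truncating division is harmless: weight x is a natural number, so it
-- exceeds n/2 exactly when it exceeds the floor of n/2.  Proofs of _>_ on ℕ
-- are unique, so ℬ n has exactly one element per string of this kind.
ℬ : ℕ → Set
ℬ n = Σ[ x ∈ BitString (suc n) ] weight x > n / 2

distance-nonZero : ∀ {n} {x y : BitString n} → x ≢ y → NonZero (distance x y)
distance-nonZero {x = []}    {[]}    x≢y = ⊥-elim (x≢y refl)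
distance-nonZero {x = a ∷ x} {b ∷ y} x≢y with a ≟ b
... | yes refl = distance-nonZero (λ x≡y → x≢y (cong (a ∷_) x≡y))
... | no  _    = _

{-# OPTIONS --safe #-}
module Submission where

-- Reading 0 and 1 as opening and closing brackets, x lies on the symmetric chain
-- of all strings with the same matched pairs; ψ moves x half way to the top of
-- its chain and records the parity of the number b of unmatched 0s in an extra
-- bit, placed in front.  Moving x along its chain is a reversible transducer:
-- one counter, reflected at zero, reads x from right to left starting at ⌊b/2⌋
-- and ends at the number of unmatched 1s.  Running it backwards inverts ψ, since
-- that last number is affine in the weight of ψ x and its extra bit.
-- Both Lipschitz bounds come from a potential: for two runs, the number of
-- differing outputs plus the distance of the counters grows by at most 3 where
-- the inputs differ and by nothing elsewhere.  The initial counters contribute at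
-- most 1 (for ψ) and at most 2 (for ψ⁻¹) per differing bit.

open import Defs
open import Data.Bool.Base using (Bool; true; false)
open import Data.Integer.Base using (+_)
import Data.Integer.Base as ℤ
import Data.Integer.Properties as ℤ
open import Data.Nat.Base
  using (ℕ; zero; suc; pred; _+_; _*_; _∸_; _≡ᵇ_; ∣_-_∣; ⌊_/2⌋; ⌈_/2⌉; _<_; z≤n; s≤s; s≤s⁻¹; NonZero)
import Data.Nat.Base as ℕ
open import Data.Nat.Divisibility using (_∣_; divides)
open import Data.Nat.DivMod using (m*n/n≡m)
open import Data.Nat.Properties
open import Data.Nat.Tactic.RingSolver using (solve-∀)
open import Data.Product.Base using (Σ-syntax; _×_; proj₁; _,_)
open import Data.Rational.Base using (_/_; _≤_)
import Data.Rational.Properties as ℚ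
import Data.Rational.Unnormalised.Base as ℚᵘ
import Data.Rational.Unnormalised.Properties as ℚᵘ
open import Data.Sum.Base using (inj₁; inj₂)
open import Data.Vec.Base using ([]; _∷_)
open import Function.Base using (_∘_)
open import Function.Bundles using (_⤖_; module Bijection; _↔_; mk↔ₛ′)
open import Function.Properties.Inverse using (↔⇒⤖)
open import Relation.Binary.PropositionalEquality
  using (_≡_; _≢_; refl; sym; trans; cong; cong₂; subst₂; module ≡-Reasoning)
open import Relation.Nullary.Decidable.Core using (yes; no)

private variable n : ℕ

-- Indicators and absolute differences under unit shifts.

𝟙 : Bool → ℕ
𝟙 true  = 1
𝟙 false = 0

𝟙≤1 : ∀ c → 𝟙 c ℕ.≤ 1
𝟙≤1 true  = ≤-refl
𝟙≤1 false = z≤n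

∣m-1+n∣≤1+∣m-n∣ : ∀ m n → ∣ m - suc n ∣ ℕ.≤ suc ∣ m - n ∣
∣m-1+n∣≤1+∣m-n∣ zero    n       = ≤-refl
∣m-1+n∣≤1+∣m-n∣ (suc m) zero    = m≤n⇒m≤1+n (m≤n⇒m≤1+n (≤-reflexive (∣-∣-identityʳ m)))
∣m-1+n∣≤1+∣m-n∣ (suc m) (suc n) = ∣m-1+n∣≤1+∣m-n∣ m n

∣1+m-n∣≤1+∣m-n∣ : ∀ m n → ∣ suc m - n ∣ ℕ.≤ suc ∣ m - n ∣
∣1+m-n∣≤1+∣m-n∣ m n = subst₂ (λ k l → k ℕ.≤ suc l) (∣-∣-comm n (suc m)) (∣-∣-comm n m) (∣m-1+n∣≤1+∣m-n∣ n m)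

∣m-1+n∣≤2+∣1+m-n∣ : ∀ m n → ∣ m - suc n ∣ ℕ.≤ 2 + ∣ suc m - n ∣
∣m-1+n∣≤2+∣1+m-n∣ m n = ≤-trans (∣m-1+n∣≤1+∣m-n∣ (suc m) (suc n)) (s≤s (∣m-1+n∣≤1+∣m-n∣ (suc m) n))

∣1+m-n∣≤2+∣m-1+n∣ : ∀ m n → ∣ suc m - n ∣ ℕ.≤ 2 + ∣ m - suc n ∣
∣1+m-n∣≤2+∣m-1+n∣ m n = ≤-trans (∣1+m-n∣≤1+∣m-n∣ (suc m) (suc n)) (s≤s (∣1+m-n∣≤1+∣m-n∣ m (suc n)))

-- The transducer and its inverse.

level : ℕ → BitString n → ℕ
level t []          = t
level t (true  ∷ x) = suc (level t x)
level t (false ∷ x) = pred (level t x)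

-- Recursion on the vector reads it from the right, so `level t x` is the counter met by the bit in
-- front of `x`. A 0 meeting a zero counter is flipped: the rightmost `t` unmatched 0s stay, all
-- further ones rise.
raise : ℕ → BitString n → BitString n
raise t []          = []
raise t (true  ∷ x) = true ∷ raise t x
raise t (false ∷ x) = (level t x ≡ᵇ 0) ∷ raise t x

-- The inverse transducer, from left to right: `lower` is its output and `excess`
-- its final counter.
excess : ℕ → BitString n → ℕ
excess v       []          = v
excess v       (false ∷ z) = excess (suc v) z
excess zero    (true  ∷ z) = excess zero z
excess (suc v) (true  ∷ z) = excess v z

lower : ℕ → BitString n → BitString n
lower v       []          = []
lower v       (false ∷ z) = false ∷ lower (suc v) z
lower zero    (true  ∷ z) = false ∷ lower zero z
lower (suc v) (true  ∷ z) = true  ∷ lower v z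

-- Output bit and new counter determine input bit and old counter: output 0 comes from a 0 that
-- decreased the counter, output 1 from a flipped 0 if the new counter is zero and from a 1
-- otherwise.
lower-raise : ∀ t (x : BitString n) → lower (level t x) (raise t x) ≡ x
lower-raise t []          = refl
lower-raise t (true  ∷ x) = cong (true ∷_) (lower-raise t x)
lower-raise t (false ∷ x) with level t x | lower-raise t x
... | zero  | ih = cong (false ∷_) ih
... | suc _ | ih = cong (false ∷_) ih

level-lower : ∀ v (z : BitString n) → level (excess v z) (lower v z) ≡ v
level-lower v       []          = refl
level-lower v       (false ∷ z) = cong pred (level-lower (suc v) z)
level-lower zero    (true  ∷ z) = cong pred (level-lower zero z)
level-lower (suc v) (true  ∷ z) = cong suc (level-lower v z)

raise-lower : ∀ v (z : BitString n) → raise (excess v z) (lower v z) ≡ z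
raise-lower v       []          = refl
raise-lower v       (false ∷ z) = cong₂ (λ l → (l ≡ᵇ 0) ∷_) (level-lower (suc v) z) (raise-lower (suc v) z)
raise-lower zero    (true  ∷ z) = cong₂ (λ l → (l ≡ᵇ 0) ∷_) (level-lower zero z) (raise-lower zero z)
raise-lower (suc v) (true  ∷ z) = cong (true ∷_) (raise-lower v z)

-- At each bit the counter changes by +1, 0 or -1 according as input and output together contain
-- two, one or no 1s.
weight-raise : ∀ t (x : BitString n) → t + (weight x + weight (raise t x)) ≡ level t x + n
weight-raise t [] = refl
weight-raise {n = suc n} t (true ∷ x) = begin
  t + (suc (weight x) + suc (weight (raise t x)))  ≡⟨ shift t (weight x) _ ⟩
  2 + (t + (weight x + weight (raise t x)))        ≡⟨ cong (suc ∘ suc) (weight-raise t x) ⟩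
  2 + (level t x + n)                              ≡⟨ cong suc (+-suc (level t x) n) ⟨
  suc (level t x) + suc n                          ∎
  where
  open ≡-Reasoning
  shift : ∀ a b c → a + (suc b + suc c) ≡ 2 + (a + (b + c))
  shift = solve-∀
weight-raise {n = suc n} t (false ∷ x) with level t x | weight-raise t x
... | zero  | ih = trans (cong (λ k → t + k) (+-suc (weight x) _)) (trans (+-suc t _) (cong suc ih))
... | suc l | ih = trans ih (sym (+-suc l n))

-- Unmatched brackets.

-- The number of unmatched 0s; that of unmatched 1s is `level 0 x`.
opens : BitString n → ℕ
opens []          = 0
opens (true  ∷ x) = opens x
opens (false ∷ x) = 𝟙 (level 0 x ≡ᵇ 0) + opens x

-- The initial `t` acts like `t` extra 1s to the right of `x`, consumed one by one by the unmatched
-- 0s.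
level-opens : ∀ t (x : BitString n) → level t x ≡ level 0 x + (t ∸ opens x)
level-opens t []          = refl
level-opens t (true  ∷ x) = cong suc (level-opens t x)
level-opens t (false ∷ x) with level 0 x | level-opens t x
... | suc l | ih = cong pred ih
... | zero  | ih = trans (cong pred ih) (pred[m∸n]≡m∸[1+n] t (opens x))

-- A matched pair and an unmatched 1 each add two to both sides, an unmatched 0 adds one.
opens-balance : ∀ (x : BitString n) → level 0 x + n ≡ opens x + weight x * 2
opens-balance [] = refl
opens-balance {n = suc n} (true ∷ x) = begin
  suc (level 0 x + suc n)          ≡⟨ cong suc (+-suc (level 0 x) n) ⟩
  2 + (level 0 x + n)              ≡⟨ cong (suc ∘ suc) (opens-balance x) ⟩
  2 + (opens x + weight x * 2)     ≡⟨ shift (opens x) _ ⟩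
  opens x + (2 + weight x * 2)     ∎
  where
  open ≡-Reasoning
  shift : ∀ a b → 2 + (a + b) ≡ a + (2 + b)
  shift = solve-∀
opens-balance {n = suc n} (false ∷ x) with level 0 x | opens-balance x
... | zero  | ih = cong suc ih
... | suc l | ih = trans (+-suc l n) ih

-- The sum serves as a potential: when equal 0s are unmatched on one side only, the gap of `opens`
-- grows by at most one while the gap of levels shrinks by one. Differing bits add at most two.
opens-lipschitz : (x y : BitString n) →
  ∣ level 0 x - level 0 y ∣ + ∣ opens x - opens y ∣ ℕ.≤ distance x y * 2
opens-lipschitz []          []          = z≤n
opens-lipschitz (true  ∷ x) (true  ∷ y) = opens-lipschitz x y
opens-lipschitz (false ∷ x) (false ∷ y) with level 0 x | level 0 y | opens-lipschitz x y
... | zero  | zero  | ih = ih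
... | suc p | suc q | ih = ih
... | zero  | suc q | ih = ≤-trans (+-monoʳ-≤ q (∣1+m-n∣≤1+∣m-n∣ (opens x) (opens y)))
                             (≤-trans (≤-reflexive (+-suc q _)) ih)
... | suc p | zero  | ih rewrite ∣-∣-identityʳ p =
  ≤-trans (+-monoʳ-≤ p (∣m-1+n∣≤1+∣m-n∣ (opens x) (opens y))) (≤-trans (≤-reflexive (+-suc p _)) ih)
opens-lipschitz (false ∷ x) (true ∷ y) with level 0 x | opens-lipschitz x y
... | zero  | ih = s≤s (≤-trans (+-monoʳ-≤ (level 0 y) (∣1+m-n∣≤1+∣m-n∣ (opens x) (opens y)))
                     (≤-trans (≤-reflexive (+-suc (level 0 y) _)) (s≤s ih)))
... | suc p | ih = ≤-trans (+-monoˡ-≤ _ (∣m-1+n∣≤2+∣1+m-n∣ p (level 0 y))) (s≤s (s≤s ih))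
opens-lipschitz (true ∷ x) (false ∷ y) with level 0 y | opens-lipschitz x y
... | zero  | ih rewrite ∣-∣-identityʳ (level 0 x) =
  s≤s (≤-trans (+-monoʳ-≤ (level 0 x) (∣m-1+n∣≤1+∣m-n∣ (opens x) (opens y)))
        (≤-trans (≤-reflexive (+-suc (level 0 x) _)) (s≤s ih)))
... | suc q | ih = ≤-trans (+-monoˡ-≤ _ (∣1+m-n∣≤2+∣m-1+n∣ (level 0 x) q)) (s≤s (s≤s ih))

-- Lipschitz bounds for both transducers and for the weight.

+-≤-step : ∀ d {k l m r} → l ℕ.≤ k + m → d + m ℕ.≤ r → d + l ℕ.≤ k + r
+-≤-step d {k} {l} {m} {r} l≤k+m d+m≤r = begin
  d + l        ≤⟨ +-monoʳ-≤ d l≤k+m ⟩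
  d + (k + m)  ≡⟨ swap d k m ⟩
  k + (d + m)  ≤⟨ +-monoʳ-≤ k d+m≤r ⟩
  k + r        ∎
  where
  open ≤-Reasoning
  swap : ∀ a b c → a + (b + c) ≡ b + (a + c)
  swap = solve-∀

-- On equal input bits the outputs differ only when the two levels get closer.
raise-lipschitz : ∀ t t′ (x y : BitString n) →
  distance (raise t x) (raise t′ y) + ∣ level t x - level t′ y ∣ ℕ.≤ distance x y * 3 + ∣ t - t′ ∣
raise-lipschitz t t′ []          []          = ≤-refl
raise-lipschitz t t′ (true  ∷ x) (true  ∷ y) = raise-lipschitz t t′ x y
raise-lipschitz t t′ (false ∷ x) (false ∷ y) with level t x | level t′ y | raise-lipschitz t t′ x y
... | zero  | zero  | ih = ih
... | suc p | suc q | ih = ih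
... | zero  | suc q | ih = ≤-trans (≤-reflexive (sym (+-suc _ q))) ih
... | suc p | zero  | ih rewrite ∣-∣-identityʳ p = ≤-trans (≤-reflexive (sym (+-suc _ p))) ih
raise-lipschitz t t′ (false ∷ x) (true ∷ y) with level t x | raise-lipschitz t t′ x y
... | zero  | ih = +-≤-step (distance (raise t x) (raise t′ y)) (m≤n+m _ 2) ih
... | suc p | ih = s≤s (+-≤-step (distance (raise t x) (raise t′ y)) (∣m-1+n∣≤2+∣1+m-n∣ p (level t′ y)) ih)
raise-lipschitz t t′ (true ∷ x) (false ∷ y) with level t′ y | raise-lipschitz t t′ x y
... | zero  | ih rewrite ∣-∣-identityʳ (level t x) =
  +-≤-step (distance (raise t x) (raise t′ y)) (m≤n+m _ 2) ih
... | suc q | ih = s≤s (+-≤-step (distance (raise t x) (raise t′ y)) (∣1+m-n∣≤2+∣m-1+n∣ (level t x) q) ih)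

-- Equal bits give different outputs only if exactly one counter is zero, and then the counters get
-- one closer. Differing bits cost at most one output and two units of counter distance.
lower-lipschitz : ∀ v v′ (z w : BitString n) →
  distance (lower v z) (lower v′ w) ℕ.≤ distance z w * 3 + ∣ v - v′ ∣
lower-lipschitz v       v′       []          []          = z≤n
lower-lipschitz v       v′       (false ∷ z) (false ∷ w) = lower-lipschitz (suc v) (suc v′) z w
lower-lipschitz zero    zero     (true  ∷ z) (true  ∷ w) = lower-lipschitz zero zero z w
lower-lipschitz (suc v) (suc v′) (true  ∷ z) (true  ∷ w) = lower-lipschitz v v′ z w
lower-lipschitz zero    (suc v′) (true  ∷ z) (true  ∷ w) =
  ≤-trans (s≤s (lower-lipschitz zero v′ z w)) (≤-reflexive (sym (+-suc _ v′)))
lower-lipschitz (suc v) zero     (true  ∷ z) (true  ∷ w) =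
  ≤-trans (s≤s (≤-trans (lower-lipschitz v zero z w) (≤-reflexive (cong (λ k → _ + k) (∣-∣-identityʳ v)))))
    (≤-reflexive (sym (+-suc _ v)))
lower-lipschitz v       zero     (false ∷ z) (true  ∷ w) =
  ≤-trans (lower-lipschitz (suc v) zero z w) (+-≤-step (distance z w * 3) {3}
    (≤-trans (∣1+m-n∣≤1+∣m-n∣ v 0) (s≤s (m≤n+m _ 2))) ≤-refl)
lower-lipschitz v       (suc v′) (false ∷ z) (true  ∷ w) =
  s≤s (≤-trans (lower-lipschitz (suc v) v′ z w)
    (+-≤-step (distance z w * 3) {2} (∣1+m-n∣≤2+∣m-1+n∣ v v′) ≤-refl))
lower-lipschitz zero    v′       (true  ∷ z) (false ∷ w) =
  ≤-trans (lower-lipschitz zero (suc v′) z w) (+-≤-step (distance z w * 3) {3} (s≤s (m≤n+m _ 2)) ≤-refl)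
lower-lipschitz (suc v) v′       (true  ∷ z) (false ∷ w) =
  s≤s (≤-trans (lower-lipschitz v (suc v′) z w)
    (+-≤-step (distance z w * 3) {2} (∣m-1+n∣≤2+∣1+m-n∣ v v′) ≤-refl))

weight-lipschitz : (x y : BitString n) → ∣ weight x - weight y ∣ ℕ.≤ distance x y
weight-lipschitz []          []          = z≤n
weight-lipschitz (true  ∷ x) (true  ∷ y) = weight-lipschitz x y
weight-lipschitz (false ∷ x) (false ∷ y) = weight-lipschitz x y
weight-lipschitz (true  ∷ x) (false ∷ y) =
  ≤-trans (∣1+m-n∣≤1+∣m-n∣ (weight x) (weight y)) (s≤s (weight-lipschitz x y))
weight-lipschitz (false ∷ x) (true  ∷ y) =
  ≤-trans (∣m-1+n∣≤1+∣m-n∣ (weight x) (weight y)) (s≤s (weight-lipschitz x y))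

distance-∷ : ∀ c d (x y : BitString n) → distance (c ∷ x) (d ∷ y) ≡ ∣ 𝟙 c - 𝟙 d ∣ + distance x y
distance-∷ true  true  x y = refl
distance-∷ true  false x y = refl
distance-∷ false true  x y = refl
distance-∷ false false x y = refl

-- Parity and halving.

even : ℕ → Bool
even 0             = true
even 1             = false
even (suc (suc n)) = even n

even-half : ∀ b → b + 𝟙 (even b) ≡ suc (⌊ b /2⌋ * 2)
even-half 0             = refl
even-half 1             = refl
even-half (suc (suc b)) = cong (suc ∘ suc) (even-half b)

-- Converse of `even-half`: one equation recovers both the extra bit and the initial counter.
even-half-unique : ∀ b c t → b + 𝟙 c ≡ suc (t * 2) → even b ≡ c × ⌊ b /2⌋ ≡ t
even-half-unique 0             true  zero    _  = refl , refl
even-half-unique 1             false zero    _  = refl , refl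
even-half-unique 1             true  (suc t) ()
even-half-unique (suc (suc b)) c     (suc t) eq with even-half-unique b c t (cong (pred ∘ pred) eq)
... | refl , refl = refl , refl

even-*2+ : ∀ m k → even (m * 2 + k) ≡ even k
even-*2+ zero    k = refl
even-*2+ (suc m) k = even-*2+ m k

∣𝟙-𝟙∣≤1 : ∀ c d → ∣ 𝟙 c - 𝟙 d ∣ ℕ.≤ 1
∣𝟙-𝟙∣≤1 true  true  = z≤n
∣𝟙-𝟙∣≤1 true  false = ≤-refl
∣𝟙-𝟙∣≤1 false true  = ≤-refl
∣𝟙-𝟙∣≤1 false false = z≤n

even-lipschitz : ∀ p q → ∣ 𝟙 (even p) - 𝟙 (even q) ∣ ℕ.≤ ∣ p - q ∣
even-lipschitz p q with p ≟ q
... | yes refl = ≤-trans (≤-reflexive (∣n-n∣≡0 (𝟙 (even p)))) z≤n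
... | no  p≢q  = ≤-trans (∣𝟙-𝟙∣≤1 (even p) (even q)) (n≢0⇒n>0 (p≢q ∘ ∣m-n∣≡0⇒m≡n))

-- Rounding up is forced by pairs such as 1 and 2; it costs nothing later, where the gap is bounded
-- by an even number.
⌊/2⌋-lipschitz : ∀ m n → ∣ ⌊ m /2⌋ - ⌊ n /2⌋ ∣ ℕ.≤ ⌈ ∣ m - n ∣ /2⌉
⌊/2⌋-lipschitz 0             n             = ⌊n/2⌋≤⌈n/2⌉ n
⌊/2⌋-lipschitz 1             0             = z≤n
⌊/2⌋-lipschitz 1             (suc n)       = ≤-refl
⌊/2⌋-lipschitz (suc (suc m)) 0             = ⌊n/2⌋≤⌈n/2⌉ (suc (suc m))
⌊/2⌋-lipschitz (suc (suc m)) 1             = ≤-reflexive (∣-∣-identityʳ _)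
⌊/2⌋-lipschitz (suc (suc m)) (suc (suc n)) = ⌊/2⌋-lipschitz m n

∣m+n-o+p∣≤∣m-o∣+∣n-p∣ : ∀ m n o p → ∣ m + n - o + p ∣ ℕ.≤ ∣ m - o ∣ + ∣ n - p ∣
∣m+n-o+p∣≤∣m-o∣+∣n-p∣ m n o p = begin
  ∣ m + n - o + p ∣                      ≤⟨ ∣-∣-triangle (m + n) (o + n) (o + p) ⟩
  ∣ m + n - o + n ∣ + ∣ o + n - o + p ∣  ≡⟨ cong₂ (λ k l → ∣ k - l ∣ + ∣ o + n - o + p ∣) (+-comm m n) (+-comm o n) ⟩
  ∣ n + m - n + o ∣ + ∣ o + n - o + p ∣  ≡⟨ cong₂ _+_ (∣m+n-m+o∣≡∣n-o∣ n m o) (∣m+n-m+o∣≡∣n-o∣ o n p) ⟩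
  ∣ m - o ∣ + ∣ n - p ∣                  ∎
  where open ≤-Reasoning

-- The map ψ and its inverse.

encode : BitString n → BitString (suc n)
encode x = even (opens x) ∷ raise ⌊ opens x /2⌋ x

-- The `level 0` of the preimage of z under `encode`; the subtraction is exact
-- on ℬ n.
entry : BitString (suc n) → ℕ
entry {n} (c ∷ z) = (weight z * 2 + 𝟙 c) ∸ suc n

decode : BitString (suc n) → BitString n
decode (c ∷ z) = lower (entry (c ∷ z)) z

level≡level-0 : ∀ {t} (x : BitString n) → t ℕ.≤ opens x → level t x ≡ level 0 x
level≡level-0 {t = t} x t≤b = begin
  level t x                      ≡⟨ level-opens t x ⟩
  level 0 x + (t ∸ opens x)      ≡⟨ cong (λ k → level 0 x + k) (m≤n⇒m∸n≡0 t≤b) ⟩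
  level 0 x + 0                  ≡⟨ +-identityʳ _ ⟩
  level 0 x                      ∎
  where open ≡-Reasoning

level-half : (x : BitString n) → level ⌊ opens x /2⌋ x ≡ level 0 x
level-half x = level≡level-0 x (⌊n/2⌋≤n (opens x))

-- This affine relation is what lets `entry` read off the final counter, and its right side is at
-- least `suc n`, which puts the image above the threshold.
weight-encode : (x : BitString n) →
  weight (raise ⌊ opens x /2⌋ x) * 2 + 𝟙 (even (opens x)) ≡ level 0 x + suc n
weight-encode {n} x = +-cancelʳ-≡ ((t + u) * 2) _ _ (begin
  (w * 2 + e) + (t + u) * 2          ≡⟨ lemma₁ w e t u ⟩
  (t + (u + w)) + (t + (u + w)) + e  ≡⟨ cong (λ k → k + k + e) balance ⟩
  (a + n) + (a + n) + e              ≡⟨ cong (λ k → (a + n) + k + e) (opens-balance x) ⟩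
  (a + n) + (b + u * 2) + e          ≡⟨ lemma₂ a n b u e ⟩
  (a + n) + (b + e) + u * 2          ≡⟨ cong (λ k → (a + n) + k + u * 2) (even-half b) ⟩
  (a + n) + suc (t * 2) + u * 2      ≡⟨ lemma₃ a n t u ⟩
  (a + suc n) + (t + u) * 2          ∎)
  where
  open ≡-Reasoning
  a = level 0 x
  b = opens x
  t = ⌊ b /2⌋
  u = weight x
  w = weight (raise t x)
  e = 𝟙 (even b)
  balance : t + (u + w) ≡ a + n
  balance = trans (weight-raise t x) (cong (λ k → k + n) (level-half x))
  lemma₁ : ∀ w e t u → (w * 2 + e) + (t + u) * 2 ≡ (t + (u + w)) + (t + (u + w)) + e
  lemma₁ = solve-∀
  lemma₂ : ∀ a n b u e → (a + n) + (b + u * 2) + e ≡ (a + n) + (b + e) + u * 2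
  lemma₂ = solve-∀
  lemma₃ : ∀ a n t u → (a + n) + suc (t * 2) + u * 2 ≡ (a + suc n) + (t + u) * 2
  lemma₃ = solve-∀

decode-encode : (x : BitString n) → decode (encode x) ≡ x
decode-encode {n} x = begin
  lower (entry (encode x)) (raise t x)  ≡⟨ cong (λ v → lower v (raise t x)) entry-encode ⟩
  lower (level t x) (raise t x)         ≡⟨ lower-raise t x ⟩
  x                                     ∎
  where
  open ≡-Reasoning
  t = ⌊ opens x /2⌋
  entry-encode : entry (encode x) ≡ level t x
  entry-encode = trans (cong (λ k → k ∸ suc n) (weight-encode x))
                   (trans (m+n∸n≡m (level 0 x) (suc n)) (sym (level-half x)))

-- Converse of `weight-encode`: the conclusion is the hypothesis of `even-half-unique` for the
-- decoded string.
opens-lower : ∀ v c (z : BitString n) → v + suc n ≡ weight z * 2 + 𝟙 c →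
  opens (lower v z) + 𝟙 c ≡ suc (excess v z * 2)
opens-lower {n} v c z v+1+n≡2w+c = begin
  b + 𝟙 c              ≡⟨ cong (λ k → k + 𝟙 c) (+-identityʳ b) ⟨
  b + 0 + 𝟙 c          ≡⟨ cong (λ k → b + k + 𝟙 c) (m≤n⇒m∸n≡0 t≤b) ⟨
  b + (t ∸ b) + 𝟙 c    ≡⟨ total ⟩
  suc (t * 2)          ∎
  where
  open ≡-Reasoning
  x = lower v z
  t = excess v z
  a = level 0 x
  b = opens x
  u = weight x
  w = weight z
  balance : t + (u + w) ≡ v + n
  balance = subst₂ (λ y l → t + (u + weight y) ≡ l + n) (raise-lower v z) (level-lower v z) (weight-raise t x)
  v≡a+[t∸b] : v ≡ a + (t ∸ b)
  v≡a+[t∸b] = trans (sym (level-lower v z)) (level-opens t x)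
  lemma₁ : ∀ b d e u r → (b + d + e) + (u * 2 + r) ≡ (b + u * 2) + d + e + r
  lemma₁ = solve-∀
  lemma₂ : ∀ a n d e r → (a + n) + d + e + r ≡ (a + d) + n + (r + e)
  lemma₂ = solve-∀
  lemma₃ : ∀ t u w e → (t + (u + w)) + (t + (u + w) + e) ≡ (t * 2 + u * 2) + (w * 2 + e)
  lemma₃ = solve-∀
  lemma₄ : ∀ t u v n → (t * 2 + u * 2) + (v + suc n) ≡ suc (t * 2) + (u * 2 + (v + n))
  lemma₄ = solve-∀
  total : b + (t ∸ b) + 𝟙 c ≡ suc (t * 2)
  total = +-cancelʳ-≡ (u * 2 + (v + n)) _ _ (begin
    (b + (t ∸ b) + 𝟙 c) + (u * 2 + (v + n))    ≡⟨ lemma₁ b (t ∸ b) (𝟙 c) u (v + n) ⟩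
    (b + u * 2) + (t ∸ b) + 𝟙 c + (v + n)      ≡⟨ cong (λ k → k + (t ∸ b) + 𝟙 c + (v + n)) (opens-balance x) ⟨
    (a + n) + (t ∸ b) + 𝟙 c + (v + n)          ≡⟨ lemma₂ a n (t ∸ b) (𝟙 c) (v + n) ⟩
    (a + (t ∸ b)) + n + (v + n + 𝟙 c)          ≡⟨ cong (λ k → k + n + (v + n + 𝟙 c)) v≡a+[t∸b] ⟨
    (v + n) + (v + n + 𝟙 c)                    ≡⟨ cong (λ k → k + (k + 𝟙 c)) balance ⟨
    (t + (u + w)) + (t + (u + w) + 𝟙 c)        ≡⟨ lemma₃ t u w (𝟙 c) ⟩
    (t * 2 + u * 2) + (w * 2 + 𝟙 c)            ≡⟨ cong (λ k → t * 2 + u * 2 + k) v+1+n≡2w+c ⟨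
    (t * 2 + u * 2) + (v + suc n)              ≡⟨ lemma₄ t u v n ⟩
    suc (t * 2) + (u * 2 + (v + n))            ∎)
  1+2t≡t+[1+t] : ∀ t → suc (t * 2) ≡ t + suc t
  1+2t≡t+[1+t] = solve-∀
  t≤b : t ℕ.≤ b
  t≤b with ≤-total t b
  ... | inj₁ t≤b = t≤b
  -- Here `total` reads `t + 𝟙 c ≡ suc (t * 2)`, so `suc t ≡ 𝟙 c` is at most 1 and `t` is 0.
  ... | inj₂ b≤t = ≤-trans (s≤s⁻¹ (≤-trans (≤-reflexive 1+t≡c) (𝟙≤1 c))) z≤n
    where
    1+t≡c : suc t ≡ 𝟙 c
    1+t≡c = +-cancelˡ-≡ t _ _ (begin
      t + suc t          ≡⟨ 1+2t≡t+[1+t] t ⟨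
      suc (t * 2)        ≡⟨ total ⟨
      b + (t ∸ b) + 𝟙 c  ≡⟨ cong (λ k → k + 𝟙 c) (m+[n∸m]≡n b≤t) ⟩
      t + 𝟙 c            ∎)

-- `encode` recomputes the bit `c` and starts its counter where the inverse run ended, so
-- `raise-lower` applies.
encode-decode : ∀ c (z : BitString n) → entry (c ∷ z) + suc n ≡ weight z * 2 + 𝟙 c →
  encode (decode (c ∷ z)) ≡ c ∷ z
encode-decode c z eq
  with even-half-unique _ c (excess (entry (c ∷ z)) z) (opens-lower (entry (c ∷ z)) c z eq)
... | even≡c , half≡t = cong₂ _∷_ even≡c
        (trans (cong (λ t → raise t (decode (c ∷ z))) half≡t) (raise-lower (entry (c ∷ z)) z))

-- The constants 4 and 5.

even-level : 2 ∣ n → (x : BitString n) → even (level 0 x) ≡ even (opens x)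
even-level {n} (divides m n≡2m) x = begin
  even (level 0 x)               ≡⟨ even-*2+ m (level 0 x) ⟨
  even (m * 2 + level 0 x)       ≡⟨ cong (λ k → even (k + level 0 x)) n≡2m ⟨
  even (n + level 0 x)           ≡⟨ cong even (+-comm n _) ⟩
  even (level 0 x + n)           ≡⟨ cong even (opens-balance x) ⟩
  even (opens x + weight x * 2)  ≡⟨ cong even (+-comm (opens x) _) ⟩
  even (weight x * 2 + opens x)  ≡⟨ even-*2+ (weight x) (opens x) ⟩
  even (opens x)                 ∎
  where open ≡-Reasoning

encode-lipschitz : 2 ∣ n → (x y : BitString n) → distance (encode x) (encode y) ℕ.≤ distance x y * 4
encode-lipschitz 2∣n x y = begin
  distance (encode x) (encode y)
    ≡⟨ distance-∷ (even b) (even b′) (raise t x) (raise t′ y) ⟩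
  ∣ 𝟙 (even b) - 𝟙 (even b′) ∣ + r
    ≡⟨ cong₂ (λ c d → ∣ 𝟙 c - 𝟙 d ∣ + r) (even-level 2∣n x) (even-level 2∣n y) ⟨
  ∣ 𝟙 (even (level 0 x)) - 𝟙 (even (level 0 y)) ∣ + r
    -- The parity bit is charged to the gap of the final counters, which `raise-lipschitz` bounds
    -- together with the outputs, so it does not raise the constant.
    ≤⟨ +-monoˡ-≤ r (even-lipschitz (level 0 x) (level 0 y)) ⟩
  ∣ level 0 x - level 0 y ∣ + r
    ≡⟨ +-comm _ r ⟩
  r + ∣ level 0 x - level 0 y ∣
    ≡⟨ cong₂ (λ k l → r + ∣ k - l ∣) (level-half x) (level-half y) ⟨
  r + ∣ level t x - level t′ y ∣
    ≤⟨ raise-lipschitz t t′ x y ⟩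
  D * 3 + ∣ t - t′ ∣
    ≤⟨ +-monoʳ-≤ (D * 3) t-t′≤D ⟩
  D * 3 + D
    ≡⟨ 3D+D≡4D D ⟩
  D * 4 ∎
  where
  open ≤-Reasoning
  D = distance x y
  b = opens x
  b′ = opens y
  t = ⌊ b /2⌋
  t′ = ⌊ b′ /2⌋
  r = distance (raise t x) (raise t′ y)
  3D+D≡4D : ∀ D → D * 3 + D ≡ D * 4
  3D+D≡4D = solve-∀
  D*2≡D+D : ∀ D → D * 2 ≡ D + D
  D*2≡D+D = solve-∀
  t-t′≤D : ∣ t - t′ ∣ ℕ.≤ D
  t-t′≤D = begin
    ∣ t - t′ ∣          ≤⟨ ⌊/2⌋-lipschitz b b′ ⟩
    ⌈ ∣ b - b′ ∣ /2⌉    ≤⟨ ⌈n/2⌉-mono (≤-trans (m≤n+m _ _) (opens-lipschitz x y)) ⟩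
    ⌈ D * 2 /2⌉         ≡⟨ cong ⌈_/2⌉ (D*2≡D+D D) ⟩
    ⌈ D + D /2⌉         ≡⟨ n≡⌈n+n/2⌉ D ⟨
    D                   ∎

decode-lipschitz : ∀ c d (z w : BitString n) →
  entry (c ∷ z) + suc n ≡ weight z * 2 + 𝟙 c → entry (d ∷ w) + suc n ≡ weight w * 2 + 𝟙 d →
  distance (decode (c ∷ z)) (decode (d ∷ w)) ℕ.≤ distance (c ∷ z) (d ∷ w) * 5
decode-lipschitz {n} c d z w eq eq′ = begin
  distance (lower v z) (lower v′ w)
    ≤⟨ lower-lipschitz v v′ z w ⟩
  D * 3 + ∣ v - v′ ∣
    ≡⟨ cong (λ k → D * 3 + k) v-v′≡ ⟩
  D * 3 + ∣ weight z * 2 + 𝟙 c - weight w * 2 + 𝟙 d ∣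
    ≤⟨ +-monoʳ-≤ (D * 3) (∣m+n-o+p∣≤∣m-o∣+∣n-p∣ (weight z * 2) (𝟙 c) (weight w * 2) (𝟙 d)) ⟩
  D * 3 + (∣ weight z * 2 - weight w * 2 ∣ + h)
    ≡⟨ cong (λ k → D * 3 + (k + h)) (*-distribʳ-∣-∣ 2 (weight z) (weight w)) ⟨
  D * 3 + (∣ weight z - weight w ∣ * 2 + h)
    ≤⟨ +-monoʳ-≤ (D * 3) (+-monoˡ-≤ h (*-monoˡ-≤ 2 (weight-lipschitz z w))) ⟩
  D * 3 + (D * 2 + h)
    -- Bits of `z` cost 3 in the run and 2 through the doubled weight in `entry`; the front bit
    -- costs 1, padded here to 5.
    ≤⟨ m≤m+n _ (h * 4) ⟩
  D * 3 + (D * 2 + h) + h * 4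
    ≡⟨ collect D h ⟩
  (h + D) * 5
    ≡⟨ cong (λ k → k * 5) (distance-∷ c d z w) ⟨
  distance (c ∷ z) (d ∷ w) * 5 ∎
  where
  open ≤-Reasoning
  D = distance z w
  h = ∣ 𝟙 c - 𝟙 d ∣
  v = entry (c ∷ z)
  v′ = entry (d ∷ w)
  collect : ∀ D h → D * 3 + (D * 2 + h) + h * 4 ≡ (h + D) * 5
  collect = solve-∀
  v-v′≡ : ∣ v - v′ ∣ ≡ ∣ weight z * 2 + 𝟙 c - weight w * 2 + 𝟙 d ∣
  v-v′≡ = begin-equality
    ∣ v - v′ ∣                                        ≡⟨ ∣m+n-m+o∣≡∣n-o∣ (suc n) v v′ ⟨
    ∣ suc n + v - suc n + v′ ∣                        ≡⟨ cong₂ ∣_-_∣ (trans (+-comm (suc n) v) eq) (trans (+-comm (suc n) v′) eq′) ⟩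
    ∣ weight z * 2 + 𝟙 c - weight w * 2 + 𝟙 d ∣       ∎

-- The threshold and the bijection.

m*2/2≡m : ∀ m → m * 2 ℕ./ 2 ≡ m
m*2/2≡m m = m*n/n≡m m 2

-- For `n` equal to `m * 2`, both inequalities say `m ≤ weight z` if the front bit is 1, and
-- `m < weight z` if it is 0.
2w+c>n⇒w>n/2 : 2 ∣ n → ∀ c (z : BitString n) → n < weight z * 2 + 𝟙 c → n ℕ./ 2 < weight (c ∷ z)
2w+c>n⇒w>n/2 (divides m refl) true  z n<2w+c rewrite m*2/2≡m m | +-comm (weight z * 2) 1 =
  s≤s (*-cancelʳ-≤ m (weight z) 2 (s≤s⁻¹ n<2w+c))
2w+c>n⇒w>n/2 (divides m refl) false z n<2w+c rewrite m*2/2≡m m | +-identityʳ (weight z * 2) =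
  *-cancelʳ-< 2 m (weight z) n<2w+c

w>n/2⇒2w+c>n : 2 ∣ n → ∀ c (z : BitString n) → n ℕ./ 2 < weight (c ∷ z) → n < weight z * 2 + 𝟙 c
w>n/2⇒2w+c>n (divides m refl) true  z n/2<w rewrite m*2/2≡m m | +-comm (weight z * 2) 1 =
  s≤s (*-monoˡ-≤ 2 (s≤s⁻¹ n/2<w))
w>n/2⇒2w+c>n (divides m refl) false z n/2<w rewrite m*2/2≡m m | +-identityʳ (weight z * 2) =
  *-monoˡ-< 2 n/2<w

entry-ℬ : 2 ∣ n → ∀ c (z : BitString n) → n ℕ./ 2 < weight (c ∷ z) →
  entry (c ∷ z) + suc n ≡ weight z * 2 + 𝟙 c
entry-ℬ 2∣n c z n/2<w = m∸n+n≡m (w>n/2⇒2w+c>n 2∣n c z n/2<w)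

encode-∈ℬ : 2 ∣ n → (x : BitString n) → n ℕ./ 2 < weight (encode x)
encode-∈ℬ {n} 2∣n x = 2w+c>n⇒w>n/2 2∣n _ (raise ⌊ opens x /2⌋ x)
  (≤-trans (m≤n+m (suc n) (level 0 x)) (≤-reflexive (sym (weight-encode x))))

BitString↔ℬ : 2 ∣ n → BitString n ↔ ℬ n
BitString↔ℬ {n} 2∣n = mk↔ₛ′ (λ x → encode x , encode-∈ℬ 2∣n x) (decode ∘ proj₁)
  (λ { (c ∷ z , p) → ℬ-≡ (encode-decode c z (entry-ℬ 2∣n c z p)) }) decode-encode
  where
  ℬ-≡ : {p q : ℬ n} → proj₁ p ≡ proj₁ q → p ≡ q
  ℬ-≡ {x , p} {.x , q} refl = cong (x ,_) (≤-irrelevant p q)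

encode-expanding : 2 ∣ n → (x y : BitString n) → distance x y ℕ.≤ distance (encode x) (encode y) * 5
encode-expanding 2∣n x y = subst₂ (λ u v → distance u v ℕ.≤ distance (encode x) (encode y) * 5)
  (decode-encode x) (decode-encode y)
  (decode-lipschitz (even (opens x)) (even (opens y)) (raise ⌊ opens x /2⌋ x) (raise ⌊ opens y /2⌋ y)
    (entry-ℬ 2∣n _ (raise ⌊ opens x /2⌋ x) (encode-∈ℬ 2∣n x))
    (entry-ℬ 2∣n _ (raise ⌊ opens y /2⌋ y) (encode-∈ℬ 2∣n y)))

-- Passage to rational ratios.

/-mono-≤ : ∀ a b c d .{{_ : NonZero b}} .{{_ : NonZero d}} → a * d ℕ.≤ c * b → + a / b ≤ + c / d
-- `_/_` reduces to lowest terms, so the cross-multiplication takes place between unnormalised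
-- fractions.
/-mono-≤ a (suc b) c (suc d) ad≤cb = ℚ.toℚᵘ-cancel-≤
  (ℚᵘ.≤-respˡ-≃ (ℚᵘ.≃-sym (ℚ.toℚᵘ-fromℚᵘ (ℚᵘ.mkℚᵘ (+ a) b)))
    (ℚᵘ.≤-respʳ-≃ (ℚᵘ.≃-sym (ℚ.toℚᵘ-fromℚᵘ (ℚᵘ.mkℚᵘ (+ c) d)))
      (ℚᵘ.*≤* (subst₂ ℤ._≤_ (ℤ.pos-* a (suc d)) (ℤ.pos-* c (suc b)) (ℤ.+≤+ ad≤cb)))))

corollary1p2 : (n : ℕ) → 0 < n → 2 ∣ n →
    Σ[ ψ ∈ BitString n ⤖ ℬ n ]
      (∀ (x y : BitString n) (x≢y : x ≢ y) →
        let ψx = proj₁ (Bijection.to ψ x)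
            ψy = proj₁ (Bijection.to ψ y)
            ratio = _/_ (+ distance ψx ψy) (distance x y) {{distance-nonZero x≢y}}
        in (+ 1 / 5) ≤ ratio × ratio ≤ (+ 4 / 1))
corollary1p2 n _ 2∣n = ↔⇒⤖ (BitString↔ℬ 2∣n) , λ x y x≢y →
  let instance _ = distance-nonZero x≢y
      D = distance x y
      E = distance (encode x) (encode y)
  in /-mono-≤ 1 5 E D (≤-trans (≤-reflexive (*-identityˡ D)) (encode-expanding 2∣n x y))
   , /-mono-≤ E D 4 1 (≤-trans (≤-reflexive (*-identityʳ E))
       (≤-trans (encode-lipschitz 2∣n x y) (≤-reflexive (*-comm D 4))))
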